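{- The following problem is undecidable: given a finite-valued nondeterministic finite transducer $T$, decide whether $T$ has bounded trailing.
   Context: An NFT is a sextuple $T=(Q,\Sigma,\Gamma,\delta,q_0,F)$ with a finite nonempty state set $Q$, finite nonempty input alphabet $\Sigma$, finite nonempty output alphabet $\Gamma$, initial state $q_0\in Q$, accepting states $F\subseteq Q$, and transition function $\delta$ mapping each $(q,\sigma)\in Q\times\Sigma$ to a finite subset of $Q\times\Gamma^\ast$. We write $q\xrightarrow{a/u}q'$ if $T$ can go from $q$ to $q'$ while reading $a\in\Sigma^\ast$ and producing $u\in\Gamma^\ast$, the concatenation of the outputs of the individual transitions (for $a$ empty, $q'=q$ and $u$ empty). $L(T)$ is the set of $(a,u)$ with $q_0\xrightarrow{a/u}f$ for some $f\in F$. $T$ is finite-valued if there is $k\in\mathbb{N}$ such that every $a\in\Sigma^\ast$ has at most $k$ words $u$ with $(a,u)\in L(T)$. $T$ has bounded trailing if there is $t\in\mathbb{N}$ such that for all $q_1,q_2\in Q$, $f_1,f_2\in F$, $a,b_1,b_2\in\Sigma^\ast$, $u,v,w_1,w_2\in\Gamma^\ast$: if $q_0\xrightarrow{a/uv}q_1\xrightarrow{b_1/w_1}f_1$ and $q_0\xrightarrow{a/u}q_2\xrightarrow{b_2/vw_2}f_2$, then $|v|\le t$. -}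

module Defs where

open import Data.Nat using (ℕ; zero; suc; _+_; _≤_)
open import Data.Fin using (Fin; toℕ)
open import Data.Bool using (Bool; true; false; if_then_else_)
open import Data.List using (List; []; _∷_; _++_; length; map)
open import Data.List.Membership.Propositional using (_∈_)
open import Data.List.Relation.Unary.All using (All)
open import Data.List.Relation.Unary.Unique.Propositional using (Unique)
open import Data.Maybe using (Maybe; just; nothing)
open import Data.Vec using (Vec; replicate; lookup; updateAt) renaming (_∷_ to _∷ᵛ_)
open import Data.Product using (Σ; ∃; ∃-syntax; _×_; _,_)
open import Relation.Binary.PropositionalEquality using (_≡_)
open import Function.Bundles using (_⇔_)

-- Nondeterministic finite transducers
--   Q = Fin (suc nQ), Σ = Fin (suc nΣ), Γ = Fin (suc nΓ)  (finite, nonempty)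
--   δ is given as a finite list of transitions (q , σ , q' , w);
--   δ(q,σ) = { (q',w) | (q,σ,q',w) ∈ transitions }, a finite subset of Q × Γ*.
--   F is given as a finite list of states.

record NFT : Set where
  field
    nQ nΣ nΓ    : ℕ
    initial     : Fin (suc nQ)
    final       : List (Fin (suc nQ))
    transitions : List (Fin (suc nQ) × Fin (suc nΣ) × Fin (suc nQ) × List (Fin (suc nΓ)))

  State  = Fin (suc nQ)
  In     = Fin (suc nΣ)
  Out    = Fin (suc nΓ)

  data Run : State → List In → List Out → State → Set where
    done : ∀ {q} → Run q [] [] q
    step : ∀ {q σ p w a u q'} → (q , σ , p , w) ∈ transitions →
           Run p a u q' → Run q (σ ∷ a) (w ++ u) q'

  InL : List In → List Out → Set
  InL a u = ∃[ f ] (f ∈ final × Run initial a u f)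

open NFT public

FiniteValued : NFT → Set
FiniteValued T = ∃[ k ] (∀ (a : List (In T)) (us : List (List (Out T))) →
  Unique us → All (InL T a) us → length us ≤ k)

BoundedTrailing : NFT → Set
BoundedTrailing T = ∃[ t ] (∀ (q₁ q₂ f₁ f₂ : State T) (a b₁ b₂ : List (In T))
  (u v w₁ w₂ : List (Out T)) →
  f₁ ∈ final T → f₂ ∈ final T →
  Run T (initial T) a (u ++ v) q₁ → Run T q₁ b₁ w₁ f₁ →
  Run T (initial T) a u q₂ → Run T q₂ b₂ (v ++ w₂) f₂ →
  length v ≤ t)

tri : ℕ → ℕ
tri zero    = zero
tri (suc n) = suc n + tri n

pair : ℕ → ℕ → ℕ
pair x y = tri (x + y) + y

codeList : List ℕ → ℕ
codeList []       = zero
codeList (x ∷ xs) = suc (pair x (codeList xs))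

codeWord : ∀ {n} → List (Fin n) → ℕ
codeWord w = codeList (map toℕ w)

codeNFT : NFT → ℕ
codeNFT T = codeList
  ( nQ T ∷ nΣ T ∷ nΓ T ∷ toℕ (initial T) ∷ codeWord (final T)
  ∷ codeList (map codeTr (transitions T)) ∷ [])
  where
  codeTr : Fin (suc (nQ T)) × Fin (suc (nΣ T)) × Fin (suc (nQ T)) × List (Fin (suc (nΓ T))) → ℕ
  codeTr (q , σ , p , w) = codeList (toℕ q ∷ toℕ σ ∷ toℕ p ∷ codeWord w ∷ [])

-- Model of computation: (Minsky) counter machines with suc r registers.
-- Input in register 0 (others 0), pc starts at 0; output read from register 0.

data Instr (r : ℕ) : Set where
  inc  : Fin (suc r) → ℕ → Instr r          -- R[i]++ ; goto j
  dec  : Fin (suc r) → ℕ → ℕ → Instr r      -- if R[i]=0 goto k else R[i]-- ; goto j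
  halt : Instr r

record Machine : Set where
  constructor machine
  field
    regs    : ℕ
    program : List (Instr regs)
open Machine public

nth : ∀ {A : Set} → List A → ℕ → Maybe A
nth []       _       = nothing
nth (x ∷ xs) zero    = just x
nth (x ∷ xs) (suc n) = nth xs n

Config : ℕ → Set
Config r = ℕ × Vec ℕ (suc r)

stepM : (M : Machine) → Config (regs M) → Maybe (Config (regs M))
stepM M (pc , R) with nth (program M) pc
... | nothing            = nothing
... | just halt          = nothing
... | just (inc i j)     = just (j , updateAt R i suc)
... | just (dec i j k) with lookup R i
...   | zero  = just (k , R)
...   | suc n = just (j , updateAt R i (λ _ → n))

-- run with fuel: nothing = still running after the fuel, just c = halted in c
runM : (M : Machine) → ℕ → Config (regs M) → Maybe (Config (regs M))
runM M zero    c = nothing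
runM M (suc n) c with stepM M c
... | nothing = just c
... | just c' = runM M n c'

initConfig : (M : Machine) → ℕ → Config (regs M)
initConfig M x = zero , (x ∷ᵛ replicate _ zero)

HaltsWith : Machine → ℕ → ℕ → Set
HaltsWith M x y = ∃[ n ] ∃[ R ] ∃[ pc ]
  (runM M n (initConfig M x) ≡ just (pc , R) × lookup R Fin.zero ≡ y)
  where import Data.Fin as Fin

DecidesBoundedTrailing : Machine → Set
DecidesBoundedTrailing M = ∀ (T : NFT) → FiniteValued T →
  ∃[ b ] (HaltsWith M (codeNFT T) (if b then 1 else 0) × (b ≡ true ⇔ BoundedTrailing T))

{-# OPTIONS --safe #-}
module Submission where

-- The transducer reads words c₀ # c₁ # ... over configurations of a counter
-- program.  After a first separator it either copies its input or, having output
-- c₀ # in advance, replaces every configuration by its successor.  Both branches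
-- are sequential, so every input has at most two outputs.  Their outputs are
-- comparable only along the actual computation from c₀, where the advancing branch
-- leads by about one configuration: trailing is bounded if the computation stops
-- and unbounded if its configurations grow without bound.
--
-- The program is chosen to compute the code of this very transducer, to run the
-- alleged decider on it, and then to grow forever on the answer "bounded" and to
-- stop on the answer "unbounded".  Self-reference costs nothing: only the first
-- transition depends on c₀, so c₀ can be the unary representation of the code of
-- the list of all other transitions.

open import Defs
open import Relation.Nullary using (¬_; yes; no; does)
open import Data.Product using (∃-syntax; _×_; _,_)
open import Data.Bool using (true; false; if_then_else_)
open import Data.Empty using (⊥; ⊥-elim)
open import Data.Fin using (Fin; zero; suc; toℕ; _≟_)
open import Data.Fin.Patterns
open import Data.Fin.Properties using (+↔⊎; *↔×; 1↔⊤; toℕ-↑ˡ)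
open import Data.List using (List; []; _∷_; _++_; length; map; concatMap; mapMaybe; replicate; cartesianProduct; allFin)
open import Data.List.Membership.Propositional using (_∈_)
open import Data.List.Membership.Propositional.Properties using (∈-allFin; ∈-cartesianProduct⁺)
open import Data.List.Properties using (++-assoc; ++-identityʳ; ++-identityʳ-unique; length-++; length-map; map-++; map-cong; ∷-injective)
open import Data.List.Relation.Unary.All as All using (All; []; _∷_)
import Data.List.Relation.Unary.AllPairs as AllPairs
open import Data.List.Relation.Unary.Any using (here; there)
open import Data.List.Relation.Unary.Unique.Propositional using (Unique)
open import Data.Maybe as Maybe using (Maybe; just; nothing)
open import Data.Nat using (ℕ; zero; suc; _+_; _*_; _≤_; _<_; z≤n; s≤s)
open import Data.Nat.Properties using (≤-trans; ≤-reflexive; module ≤-Reasoning; m≤m+n; m≤n+m; n≤1+n; <⇒≱; +-mono-≤; +-assoc; +-comm; +-suc; +-identityʳ; *-zeroʳ; suc-injective)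
open import Data.Nat.Tactic.RingSolver using (solve-∀)
open import Data.Sum using (_⊎_; inj₁; inj₂)
open import Data.Sum.Function.Propositional using (_⊎-↔_)
open import Data.Unit using (tt)
open import Data.Vec as Vec using (Vec; _∷_; lookup; updateAt)
open import Data.Vec.Properties using (lookup∘updateAt; lookup∘updateAt′; lookup-replicate)
open import Function using (case_of_)
open import Function.Bundles using (_↔_; _⇔_; Inverse; Equivalence; mk↔ₛ′)
open import Function.Properties.Inverse using (↔-refl; ↔-trans)
open import Relation.Nullary.Decidable using (dec-true; dec-false)
open import Relation.Binary.PropositionalEquality using (_≡_; _≢_; refl; sym; trans; cong; cong₂; subst; module ≡-Reasoning)

-- Preliminaries on lists.

∈-mapMaybe⁻ : ∀ {A B : Set} (f : A → Maybe B) {y} xs → y ∈ mapMaybe f xs → ∃[ x ] f x ≡ just y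
∈-mapMaybe⁻ f (x ∷ xs) y∈ with f x in eq
... | nothing = ∈-mapMaybe⁻ f xs y∈
∈-mapMaybe⁻ f (x ∷ xs) (here refl) | just _ = x , eq
∈-mapMaybe⁻ f (x ∷ xs) (there y∈)  | just _ = ∈-mapMaybe⁻ f xs y∈

∈-mapMaybe⁺ : ∀ {A B : Set} (f : A → Maybe B) {x y xs} → x ∈ xs → f x ≡ just y → y ∈ mapMaybe f xs
∈-mapMaybe⁺ f (here refl) eq rewrite eq = here refl
∈-mapMaybe⁺ f {xs = x′ ∷ _} (there x∈) eq with f x′
... | nothing = ∈-mapMaybe⁺ f x∈ eq
... | just _  = there (∈-mapMaybe⁺ f x∈ eq)

-- Among three distinct elements two would satisfy the same predicate, and each predicate has at
-- most one solution.
unique-two-valued : ∀ {A : Set} {P Q : A → Set} →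
  (∀ {x y} → P x → P y → x ≡ y) → (∀ {x y} → Q x → Q y → x ≡ y) →
  ∀ {xs} → Unique xs → All (λ x → P x ⊎ Q x) xs → length xs ≤ 2
unique-two-valued {A} {P} {Q} P! Q! = go
  where
  open AllPairs using (_∷_)
  pigeonhole : ∀ {x y z} → x ≢ y → x ≢ z → y ≢ z → P x ⊎ Q x → P y ⊎ Q y → P z ⊎ Q z → ⊥
  pigeonhole xy xz yz (inj₁ p) (inj₁ q) _        = xy (P! p q)
  pigeonhole xy xz yz (inj₁ p) (inj₂ q) (inj₁ r) = xz (P! p r)
  pigeonhole xy xz yz (inj₁ p) (inj₂ q) (inj₂ r) = yz (Q! q r)
  pigeonhole xy xz yz (inj₂ p) (inj₁ q) (inj₁ r) = yz (P! q r)
  pigeonhole xy xz yz (inj₂ p) (inj₁ q) (inj₂ r) = xz (Q! p r)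
  pigeonhole xy xz yz (inj₂ p) (inj₂ q) _        = xy (Q! p q)
  go : ∀ {xs} → Unique xs → All (λ x → P x ⊎ Q x) xs → length xs ≤ 2
  go {[]} _ _ = z≤n
  go {_ ∷ []} _ _ = s≤s z≤n
  go {_ ∷ _ ∷ []} _ _ = s≤s (s≤s z≤n)
  go {_ ∷ _ ∷ _ ∷ _} ((xy ∷ xz ∷ _) ∷ (yz ∷ _) ∷ _) (p ∷ q ∷ r ∷ _) = ⊥-elim (pigeonhole xy xz yz p q r)

++-compare : ∀ {A : Set} (as : List A) {bs cs ds} → as ++ bs ≡ cs ++ ds →
  (∃[ es ] (cs ≡ as ++ es × bs ≡ es ++ ds)) ⊎ (∃[ es ] (as ≡ cs ++ es × ds ≡ es ++ bs))
++-compare [] eq = inj₁ (_ , refl , eq)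
++-compare (a ∷ as) {cs = []} eq = inj₂ (_ , refl , sym eq)
++-compare (a ∷ as) {cs = c ∷ cs} eq with ∷-injective eq
... | refl , eq′ with ++-compare as {cs = cs} eq′
...   | inj₁ (es , refl , p) = inj₁ (es , refl , p)
...   | inj₂ (es , refl , p) = inj₂ (es , refl , p)

-- Sequential transducers and iterated passes.

module SequentialRun {A S : Set} (δ : S → A → Maybe (S × List A)) where

  infixr 5 _∷_

  data SRun : S → List A → List A → S → Set where
    []  : ∀ {s} → SRun s [] [] s
    _∷_ : ∀ {s x s′ w a u s″} → δ s x ≡ just (s′ , w) → SRun s′ a u s″ → SRun s (x ∷ a) (w ++ u) s″

  infixr 5 _++ʳ_

  _++ʳ_ : ∀ {s a u s′ b v s″} → SRun s a u s′ → SRun s′ b v s″ → SRun s (a ++ b) (u ++ v) s″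
  [] ++ʳ r = r
  _++ʳ_ {v = v} (_∷_ {w = w} {u = u} e r) r′ rewrite ++-assoc w u v = e ∷ (r ++ʳ r′)

  -- Determinism forces the longer run to begin with the run on `a`.
  run-split : ∀ a {b s u s″ u′ s′} → SRun s (a ++ b) u s″ → SRun s a u′ s′ →
    ∃[ u″ ] (u ≡ u′ ++ u″ × SRun s′ b u″ s″)
  run-split [] r [] = _ , refl , r
  run-split (x ∷ a) (e ∷ r) (_∷_ {w = w} {u = u} e′ r′) with trans (sym e) e′
  ... | refl with run-split a r r′
  ...   | u″ , refl , r″ = u″ , sym (++-assoc w u u″) , r″

  run-functional : ∀ {s a u u′ s′ s″} → SRun s a u s′ → SRun s a u′ s″ → u ≡ u′
  run-functional [] [] = refl
  run-functional (e ∷ r) (e′ ∷ r′) with trans (sym e) e′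
  ... | refl = cong (_ ++_) (run-functional r r′)

  -- A computation of configurations w, each pass of the sequential transducer
  -- rewriting the whole configuration once.
  data Trace : S → List A → S → List A → Set where
    []  : ∀ {s w} → Trace s w s w
    _∷_ : ∀ {s w s₁ w₁ s′ w′} → SRun s w w₁ s₁ → Trace s₁ w₁ s′ w′ → Trace s w s′ w′

  -- Concatenating the passes w₀ → w₁ → ... → wₖ gives one run that reads w₀...wₖ₋₁ and writes
  -- w₁...wₖ. With w₀ written in advance, the output is the input followed by wₖ.
  trace⇒run : ∀ {s w s′ w′} → Trace s w s′ w′ → ∃[ a ] ∃[ o ] (SRun s a o s′ × w ++ o ≡ a ++ w′)
  trace⇒run {w = w} [] = [] , [] , [] , ++-identityʳ w
  trace⇒run {w = w} (_∷_ {w₁ = w₁} {w′ = w′} r t) with trace⇒run t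
  ... | a , o , r′ , eq = w ++ a , w₁ ++ o , r ++ʳ r′ , trans (cong (w ++_) eq) (sym (++-assoc w a w′))

  Stuck : S → Set
  Stuck s = ∀ x → δ s x ≡ nothing

  stuck⇒[] : ∀ {s a u s′} → Stuck s → SRun s a u s′ → a ≡ [] × u ≡ []
  stuck⇒[] stuck [] = refl , refl
  stuck⇒[] stuck (_∷_ {x = x} e r) with trans (sym (stuck x)) e
  ... | ()

  -- Induction on the trace. If `a` extends beyond `w`, the run begins with the first pass, and what
  -- remains is the same situation one configuration later. If `a` ends inside `w`, then `v` is the
  -- rest of `w` followed by `o`, a prefix of `w₁`. At the end of the trace the stuck state reads
  -- nothing, and `v` is `w` itself.
  lead-bounded : ∀ {s w s′ w′} → Trace s w s′ w′ → Stuck s′ →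
    ∃[ t ] (∀ {a o q} v → SRun s a o q → w ++ o ≡ a ++ v → length v ≤ t)
  lead-bounded {w = w} [] stuck = length w , bound
    where
    bound : ∀ {a o q} v → SRun _ a o q → w ++ o ≡ a ++ v → length v ≤ length w
    bound v r eq with stuck⇒[] stuck r
    ... | refl , refl = ≤-reflexive (cong length (trans (sym eq) (++-identityʳ w)))
  lead-bounded {w = w} (_∷_ {w₁ = w₁} r t) stuck with lead-bounded t stuck
  ... | k , rest = length w + length w₁ + k , bound
    where
    bound : ∀ {a o q} v → SRun _ a o q → w ++ o ≡ a ++ v → length v ≤ length w + length w₁ + k
    bound {a} v r′ eq with ++-compare w {cs = a} eq
    ... | inj₁ (b , refl , p) with run-split w r′ r
    ...   | _ , refl , r″ = ≤-trans (rest v r″ p) (m≤n+m k _)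
    bound {a} {o} _ r′ eq | inj₂ (b , refl , refl) with run-split a r r′
    ...   | w₂ , refl , _ = begin
      length (b ++ o)                                 ≡⟨ length-++ b ⟩
      length b + length o                             ≤⟨ +-mono-≤ (m≤n+m _ (length a)) (m≤m+n _ (length w₂)) ⟩
      (length a + length b) + (length o + length w₂)  ≡⟨ cong₂ _+_ (length-++ a) (length-++ o) ⟨
      length (a ++ b) + length (o ++ w₂)              ≤⟨ m≤m+n _ k ⟩
      length (a ++ b) + length (o ++ w₂) + k          ∎
      where open ≤-Reasoning

  -- Copying cannot get ahead: it would have to read w and then every later
  -- configuration, but the advancing run is blocked at the last one.
  no-overtaking : ∀ {s w s′ x w′} → Trace s w s′ (x ∷ w′) → Stuck s′ →
    ∀ {o q} v → SRun s (w ++ o ++ v) o q → ⊥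
  no-overtaking [] stuck v r with stuck⇒[] stuck r
  ... | () , _
  no-overtaking {w = w} (_∷_ {w₁ = w₁} r t) stuck {o} v r′ with run-split w r′ r
  ... | o′ , refl , r″ = no-overtaking t stuck v (subst (λ a → SRun _ a o′ _) (++-assoc w₁ o′ v) r″)

-- Codes of transducers.

-- `codeNFT` codes transitions by a local function; this global counterpart lets later statements
-- speak of the code of a part of the list.
codeTransition : ∀ {k l m n} → Fin k × Fin l × Fin m × List (Fin n) → ℕ
codeTransition (q , x , q′ , w) = codeList (toℕ q ∷ toℕ x ∷ toℕ q′ ∷ codeWord w ∷ [])

codeNFT-unfold : ∀ T → codeNFT T ≡ codeList
  ( nQ T ∷ nΣ T ∷ nΓ T ∷ toℕ (initial T) ∷ codeWord (final T)
  ∷ codeList (map codeTransition (transitions T)) ∷ [])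
codeNFT-unfold T = cong
  (λ codes → codeList ( nQ T ∷ nΣ T ∷ nΓ T ∷ toℕ (initial T) ∷ codeWord (final T) ∷ codeList codes ∷ []))
  (map-cong (λ _ → refl) (transitions T))

-- Opaque because conversion checking would otherwise unfold the nested pairs.
opaque

  transducerCode : (states letters finals start word later : ℕ) → ℕ
  transducerCode q l f s w x = codeList
    (q ∷ l ∷ l ∷ 0 ∷ f ∷ suc (pair (codeList (0 ∷ 0 ∷ s ∷ w ∷ [])) x) ∷ [])

  transducerCode-unfold : ∀ q l f s w x → transducerCode q l f s w x ≡ codeList
    (q ∷ l ∷ l ∷ 0 ∷ f ∷ suc (pair (codeList (0 ∷ 0 ∷ s ∷ w ∷ [])) x) ∷ [])
  transducerCode-unfold q l f s w x = refl

-- The transducer with a copying and an advancing branch.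

module CopyOrAdvance
  {m n : ℕ} {S : Set} (states : Fin m ↔ S)
  (δ : S → Fin (suc n) → Maybe (S × List (Fin (suc n))))
  (copy start : S) (copies : ∀ x → δ copy x ≡ just (copy , x ∷ []))
  where

  open Inverse states renaming (to to decode; from to encode)
  open SequentialRun δ public

  private
    Letter : Set
    Letter = Fin (suc n)

    Transition : Set
    Transition = Fin (suc m) × Letter × Fin (suc m) × List Letter

  -- States are shifted by one: `zero` is reserved for the initial state, to which no transition
  -- returns.
  entry : Fin m × Letter → Maybe Transition
  entry (d , x) = Maybe.map (λ (s , w) → suc d , x , suc (encode s) , w) (δ (decode d) x)

  domain : List (Fin m × Letter)
  domain = cartesianProduct (allFin m) (allFin (suc n))

  laterTransitions : List Transition
  laterTransitions = (zero , zero , suc (encode copy) , []) ∷ mapMaybe entry domain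

  transducer : List Letter → NFT
  transducer c₀ = record
    -- All states accept, so every run contributes an output and trailing can be witnessed without
    -- completing the leading run.
    { nQ = m ; nΣ = n ; nΓ = n ; initial = zero ; final = allFin (suc m)
    ; transitions = (zero , zero , suc (encode start) , c₀) ∷ laterTransitions }

  laterCode : ℕ
  laterCode = codeList (map codeTransition laterTransitions)

  opaque
    unfolding transducerCode

    code-transducer : ∀ c₀ {s w x} → suc (toℕ (encode start)) ≡ s → codeWord c₀ ≡ w → laterCode ≡ x →
      codeNFT (transducer c₀) ≡ transducerCode m n (codeWord (allFin (suc m))) s w x
    code-transducer c₀ refl refl refl = trans (codeNFT-unfold (transducer c₀)) (cong codeList
      (cong (λ c → m ∷ n ∷ n ∷ 0 ∷ codeWord (allFin (suc m)) ∷ c ∷ []) prepend))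
      where
      prepend : codeList (map codeTransition (transitions (transducer c₀))) ≡
        suc (pair (codeList (0 ∷ 0 ∷ suc (toℕ (encode start)) ∷ codeWord c₀ ∷ [])) laterCode)
      prepend = cong (λ c → suc (pair c laterCode))
        (cong codeList {x = 0 ∷ 0 ∷ suc (toℕ (encode start)) ∷ codeWord c₀ ∷ []} refl)

  module _ {c₀ : List Letter} where

    private
      T : NFT
      T = transducer c₀

    copy-run : ∀ a → SRun copy a a copy
    copy-run []      = []
    copy-run (x ∷ a) = copies x ∷ copy-run a

    entry-sound : ∀ {d x q w} → (suc d , x , q , w) ∈ transitions T →
      ∃[ s ] (q ≡ suc (encode s) × δ (decode d) x ≡ just (s , w))
    entry-sound (here ())
    entry-sound (there (here ()))
    entry-sound (there (there t∈)) with ∈-mapMaybe⁻ entry domain t∈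
    ... | (d , x) , eq with δ (decode d) x in eq′
    entry-sound (there (there t∈)) | (d , x) , refl | just _ = _ , refl , eq′

    entry-initial : ∀ {x q w} → (zero , x , q , w) ∈ transitions T →
      x ≡ zero × ((q ≡ suc (encode start) × w ≡ c₀) ⊎ (q ≡ suc (encode copy) × w ≡ []))
    entry-initial (here refl) = refl , inj₁ (refl , refl)
    entry-initial (there (here refl)) = refl , inj₂ (refl , refl)
    entry-initial (there (there t∈)) with ∈-mapMaybe⁻ entry domain t∈
    ... | (d , x) , eq with δ (decode d) x
    entry-initial (there (there t∈)) | (d , x) , () | just _
    entry-initial (there (there t∈)) | (d , x) , () | nothing

    entry-complete : ∀ {s x s′ w} → δ s x ≡ just (s′ , w) →
      (suc (encode s) , x , suc (encode s′) , w) ∈ transitions T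
    entry-complete {s} {x} {s′} {w} e = there (there
      (∈-mapMaybe⁺ entry (∈-cartesianProduct⁺ (∈-allFin (encode s)) (∈-allFin x)) eq))
      where
      eq : entry (encode s , x) ≡ just (suc (encode s) , x , suc (encode s′) , w)
      eq rewrite strictlyInverseˡ s | e = refl

    sound : ∀ {d a u q} → Run T (suc d) a u q → ∃[ s ] SRun (decode d) a u s
    sound done = _ , []
    sound (step t∈ r) with entry-sound t∈
    ... | s , refl , e with sound r
    ...   | _ , r′ rewrite strictlyInverseˡ s = _ , e ∷ r′

    complete : ∀ {s a u s′} → SRun s a u s′ → Run T (suc (encode s)) a u (suc (encode s′))
    complete []      = done
    complete (e ∷ r) = step (entry-complete e) (complete r)

    data Copying : List Letter → List Letter → Set where
      -- The empty run has not chosen a branch; it is counted as copying.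
      idle    : Copying [] []
      copying : ∀ {a} → Copying (zero ∷ a) a

    data Leading : List Letter → List Letter → Set where
      leading : ∀ {a u s} → SRun start a u s → Leading (zero ∷ a) (c₀ ++ u)

    branch : ∀ {a u q} → Run T zero a u q → Copying a u ⊎ Leading a u
    branch done = inj₁ idle
    branch (step t∈ r) with entry-initial t∈
    ... | refl , inj₁ (refl , refl) with sound r
    ...   | _ , r′ rewrite strictlyInverseˡ start = inj₂ (leading r′)
    branch (step {a = a} t∈ r) | refl , inj₂ (refl , refl) with sound r
    ...   | _ , r′ rewrite strictlyInverseˡ copy =
      inj₁ (subst (Copying _) (run-functional (copy-run a) r′) copying)

    copying-functional : ∀ {a u u′} → Copying a u → Copying a u′ → u ≡ u′
    copying-functional idle    idle    = refl
    copying-functional copying copying = refl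

    leading-functional : ∀ {a u u′} → Leading a u → Leading a u′ → u ≡ u′
    leading-functional (leading r) (leading r′) = cong (c₀ ++_) (run-functional r r′)

    finiteValued : FiniteValued T
    finiteValued = 2 , λ a us unique outputs →
      unique-two-valued copying-functional leading-functional unique
        (All.map (λ (_ , _ , r) → branch r) outputs)

    -- Two runs in the same branch have equal outputs, so `v` is empty. If the advancing branch is
    -- ahead, `lead-bounded` applies; the copying branch cannot be ahead by `no-overtaking`. The
    -- last configuration must be nonempty there, since a stuck state can still read the empty word.
    boundedTrailing : ∀ {s x w} → Trace start c₀ s (x ∷ w) → Stuck s → BoundedTrailing T
    boundedTrailing trace stuck with lead-bounded trace stuck
    ... | t , lead = t , λ _ _ _ _ _ _ _ u v _ _ _ _ r₁ _ r₂ _ → bound u v refl (branch r₁) (branch r₂)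
      where
      equal : ∀ u v → u ++ v ≡ u → length v ≤ t
      equal u v eq with ++-identityʳ-unique u (sym eq)
      ... | refl = z≤n
      bound : ∀ {a} u v {uv} → uv ≡ u ++ v → Copying a uv ⊎ Leading a uv → Copying a u ⊎ Leading a u → length v ≤ t
      bound u v eq (inj₁ p) (inj₁ q) = equal u v (trans (sym eq) (copying-functional p q))
      bound u v eq (inj₂ p) (inj₂ q) = equal u v (trans (sym eq) (leading-functional p q))
      bound u v eq (inj₂ (leading r)) (inj₁ copying) = lead v r eq
      bound _ v eq (inj₁ copying) (inj₂ (leading {u = o} r)) =
        ⊥-elim (no-overtaking trace stuck v
          (subst (λ a → SRun start a o _) (trans eq (++-assoc c₀ o v)) r))

    -- By `trace⇒run`, on input `zero ∷ a` the advancing branch writes `a ++ w` while copying writes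
    -- `a`, so the trailing word is the whole configuration `w`. The copying run catches up by
    -- reading `w`.
    unboundedTrailing : (∀ t → ∃[ s ] ∃[ w ] (Trace start c₀ s w × t < length w)) → ¬ BoundedTrailing T
    unboundedTrailing grows (t , bounded) with grows t
    ... | s , w , trace , t< with trace⇒run trace
    ...   | a , o , r , eq = <⇒≱ t< (bounded _ _ _ _ (zero ∷ a) [] w a w [] []
      (∈-allFin _) (∈-allFin _)
      (subst (λ z → Run T zero _ z _) eq (step (here refl) (complete r))) done
      (step (there (here refl)) (complete (copy-run a)))
      (subst (λ z → Run T _ w z _) (sym (++-identityʳ w)) (complete (copy-run w))))

-- Words as register contents.

controlCount : ℕ → ℕ
controlCount m = 1 + (m + m)

-- substitute a u l j replaces every letter a by u, appends b^k for each (b , k) in l,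
-- and goes to j; decrement a j k removes one a and goes to j, or goes to k if there is none.
data Op (n : ℕ) (P : Set) : Set where
  substitute : Fin n → List (Fin n) → List (Fin n × ℕ) → P → Op n P
  decrement  : Fin n → P → P → Op n P
  stop       : Op n P

module Parikh {n : ℕ} where

  Word : Set
  Word = List (Fin n)

  count : Fin n → Word → ℕ
  count c []      = 0
  count c (b ∷ w) = if does (c ≟ b) then suc (count c w) else count c w

  -- Only multiplicities count. As order is free, a pass may append new letters at the end of a
  -- block and write the copies of `u` wherever the replaced letters stood.
  _represents_ : Word → Vec ℕ n → Set
  w represents v = ∀ c → lookup v c ≡ count c w

  image : Fin n → Word → Fin n → Word
  image a u b = if does (b ≟ a) then u else b ∷ []

  replace : Fin n → Word → Word → Word
  replace a u = concatMap (image a u)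

  remove : Fin n → Word → Word
  remove a []      = []
  remove a (b ∷ w) = if does (b ≟ a) then w else b ∷ remove a w

  spell : List (Fin n × ℕ) → Word
  spell = concatMap (λ (b , k) → replicate k b)

  -- The added number stands on the right here and on the left in `addAll`: adding to a cleared
  -- register gives `0 + k`, and adding a constant gives `1 + x`. Both reduce, so steps of a
  -- concrete program hold by computation.
  addTimes : ℕ → Word → Vec ℕ n → Vec ℕ n
  addTimes k []      v = v
  addTimes k (b ∷ u) v = updateAt (addTimes k u v) b (_+ k)

  addAll : List (Fin n × ℕ) → Vec ℕ n → Vec ℕ n
  addAll []            v = v
  addAll ((b , k) ∷ l) v = updateAt (addAll l v) b (k +_)

  clear : Fin n → Vec ℕ n → Vec ℕ n
  clear a v = updateAt v a (λ _ → 0)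

  count-same : ∀ b w → count b (b ∷ w) ≡ suc (count b w)
  count-same b w rewrite dec-true (b ≟ b) refl = refl

  count-other : ∀ {c b} w → c ≢ b → count c (b ∷ w) ≡ count c w
  count-other {c} {b} w c≢b rewrite dec-false (c ≟ b) c≢b = refl

  count-++ : ∀ c w w′ → count c (w ++ w′) ≡ count c w + count c w′
  count-++ c []      w′ = refl
  count-++ c (b ∷ w) w′ with does (c ≟ b)
  ... | true  = cong suc (count-++ c w w′)
  ... | false = count-++ c w w′

  count-replicate-same : ∀ b k → count b (replicate k b) ≡ k
  count-replicate-same b zero    = refl
  count-replicate-same b (suc k) = trans (count-same b (replicate k b)) (cong suc (count-replicate-same b k))

  count-replicate-other : ∀ {c b} k → c ≢ b → count c (replicate k b) ≡ 0
  count-replicate-other zero    c≢b = refl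
  count-replicate-other {b = b} (suc k) c≢b = trans (count-other (replicate k b) c≢b) (count-replicate-other k c≢b)

  lookup-addTimes : ∀ k u v c → lookup (addTimes k u v) c ≡ lookup v c + k * count c u
  lookup-addTimes k []      v c rewrite *-zeroʳ k = sym (+-identityʳ _)
  lookup-addTimes k (b ∷ u) v c with c ≟ b
  ... | yes refl rewrite lookup∘updateAt c {_+ k} (addTimes k u v) | lookup-addTimes k u v c =
    arithmetic (lookup v c) k (count c u)
    where
    arithmetic : ∀ x k y → x + k * y + k ≡ x + k * suc y
    arithmetic = solve-∀
  ... | no c≢b rewrite lookup∘updateAt′ c b {_+ k} c≢b (addTimes k u v) = lookup-addTimes k u v c

  lookup-addAll : ∀ l v c → lookup (addAll l v) c ≡ count c (spell l) + lookup v c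
  lookup-addAll []            v c = refl
  lookup-addAll ((b , k) ∷ l) v c rewrite count-++ c (replicate k b) (spell l) with c ≟ b
  ... | yes refl rewrite lookup∘updateAt c {k +_} (addAll l v) | lookup-addAll l v c
                       | count-replicate-same c k = sym (+-assoc k _ _)
  ... | no c≢b rewrite lookup∘updateAt′ c b {k +_} c≢b (addAll l v) | count-replicate-other k c≢b = lookup-addAll l v c

  count-replace : ∀ a u w c → count c (replace a u w) ≡ count c (replace a [] w) + count a w * count c u
  count-replace a u []      c = refl
  count-replace a u (b ∷ w) c with b ≟ a
  ... | yes refl rewrite count-same a w | count-++ c u (replace a u w) | count-replace a u w c =
    arithmetic (count c u) _ (count a w)
    where
    arithmetic : ∀ x y z → x + (y + z * x) ≡ y + (x + z * x)
    arithmetic = solve-∀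
  ... | no b≢a rewrite count-other {a} w (λ eq → b≢a (sym eq)) with c ≟ b
  ...   | yes _ = cong suc (count-replace a u w c)
  ...   | no _  = count-replace a u w c

  count-erase : ∀ a w → count a (replace a [] w) ≡ 0
  count-erase a []      = refl
  count-erase a (b ∷ w) with b ≟ a
  ... | yes _ = count-erase a w
  ... | no b≢a = trans (count-other (replace a [] w) (λ eq → b≢a (sym eq))) (count-erase a w)

  count-erase-other : ∀ {a c} w → c ≢ a → count c (replace a [] w) ≡ count c w
  count-erase-other []      c≢a = refl
  count-erase-other {a} {c} (b ∷ w) c≢a with b ≟ a
  ... | yes refl = trans (count-erase-other w c≢a) (sym (count-other w c≢a))
  ... | no _ with c ≟ b
  ...   | yes _ = cong suc (count-erase-other w c≢a)
  ...   | no _  = count-erase-other w c≢a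

  -- Substitution is simultaneous: occurrences of `a` in `u` are not replaced again. Hence the
  -- register is read and cleared first, and `u` is added afterwards.
  replace-represents : ∀ {w v} a u l → w represents v →
    (replace a u w ++ spell l) represents addAll l (addTimes (lookup v a) u (clear a v))
  replace-represents {w} {v} a u l rep c = begin
    lookup (addAll l (addTimes (lookup v a) u (clear a v))) c
      ≡⟨ lookup-addAll l _ c ⟩
    count c (spell l) + lookup (addTimes (lookup v a) u (clear a v)) c
      ≡⟨ cong (_ +_) (lookup-addTimes (lookup v a) u _ c) ⟩
    count c (spell l) + (lookup (clear a v) c + lookup v a * count c u)
      ≡⟨ cong₂ (λ x y → count c (spell l) + (x + y * count c u)) cleared (rep a) ⟩
    count c (spell l) + (count c (replace a [] w) + count a w * count c u)
      ≡⟨ cong (_ +_) (count-replace a u w c) ⟨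
    count c (spell l) + count c (replace a u w)
      ≡⟨ +-comm (count c (spell l)) _ ⟩
    count c (replace a u w) + count c (spell l)
      ≡⟨ count-++ c (replace a u w) (spell l) ⟨
    count c (replace a u w ++ spell l) ∎
    where
    open ≡-Reasoning
    cleared : lookup (clear a v) c ≡ count c (replace a [] w)
    cleared with c ≟ a
    ... | yes refl = trans (lookup∘updateAt c v) (sym (count-erase c w))
    ... | no c≢a   = trans (lookup∘updateAt′ c a c≢a v) (trans (rep c) (sym (count-erase-other w c≢a)))

  count-remove : ∀ a w {k} → count a w ≡ suc k → count a (remove a w) ≡ k
  count-remove a (b ∷ w) eq with b ≟ a
  ... | yes refl = suc-injective (trans (sym (count-same a w)) eq)
  ... | no b≢a with a ≟ b
  ...   | yes a≡b = ⊥-elim (b≢a (sym a≡b))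
  ...   | no _    = count-remove a w eq

  count-remove-other : ∀ {a c} w → c ≢ a → count c (remove a w) ≡ count c w
  count-remove-other []      c≢a = refl
  count-remove-other {a} {c} (b ∷ w) c≢a with b ≟ a
  ... | yes refl = sym (count-other w c≢a)
  ... | no _ with c ≟ b
  ...   | yes _ = cong suc (count-remove-other w c≢a)
  ...   | no _  = count-remove-other w c≢a

  remove-represents : ∀ {w v k} a → w represents v → lookup v a ≡ suc k →
    remove a w represents updateAt v a (λ _ → k)
  remove-represents {w} {v} a rep eq c with c ≟ a
  ... | yes refl = trans (lookup∘updateAt c v) (sym (count-remove c w (trans (sym (rep c)) eq)))
  ... | no c≢a   = trans (lookup∘updateAt′ c a c≢a v) (trans (rep c) (sym (count-remove-other w c≢a)))

  count≤length : ∀ c w → count c w ≤ length w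
  count≤length c []      = z≤n
  count≤length c (b ∷ w) with does (c ≟ b)
  ... | true  = s≤s (count≤length c w)
  ... | false = ≤-trans (count≤length c w) (n≤1+n _)

-- Counter programs run by sequential passes.

module CounterProgram {n : ℕ} {P : Set} (op : P → Op n P) where

  open Parikh {n} public

  infix 4 _⟶_
  infixr 5 _∷_

  data _⟶_ : P × Vec ℕ n → P × Vec ℕ n → Set where
    substituted : ∀ {p a u l j v} → op p ≡ substitute a u l j →
      (p , v) ⟶ (j , addAll l (addTimes (lookup v a) u (clear a v)))
    decremented : ∀ {p a j k v m} → op p ≡ decrement a j k → lookup v a ≡ suc m →
      (p , v) ⟶ (j , updateAt v a (λ _ → m))
    exhausted   : ∀ {p a j k v} → op p ≡ decrement a j k → lookup v a ≡ 0 →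
      (p , v) ⟶ (k , v)

  data _⟶*_ : P × Vec ℕ n → P × Vec ℕ n → Set where
    []  : ∀ {c} → c ⟶* c
    _∷_ : ∀ {c c′ c″} → c ⟶ c′ → c′ ⟶* c″ → c ⟶* c″

  infix 4 _⟶*_
  infixr 5 _++*_

  _++*_ : ∀ {c c′ c″} → c ⟶* c′ → c′ ⟶* c″ → c ⟶* c″
  []      ++* q = q
  (e ∷ r) ++* q = e ∷ (r ++* q)

  -- skip j copies the rest of a configuration after a successful decrement,
  -- so that execution resumes at j with the next one.
  data Control : Set where
    copy : Control
    run  : P → Control
    skip : P → Control

  Letter : Set
  Letter = Fin (suc n)

  -- One left-to-right pass suffices for each operation: constants are added at the separator, a
  -- decrement drops the first `a` it meets, and reaching the separator in state `run p` shows that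
  -- there was none.
  δ : Control → Letter → Maybe (Control × List Letter)
  δ copy     x       = just (copy , x ∷ [])
  δ (skip j) zero    = just (run j , zero ∷ [])
  δ (skip j) (suc b) = just (skip j , suc b ∷ [])
  δ (run p)  x with op p
  δ (run p)  zero    | substitute a u l j = just (run j , map suc (spell l) ++ zero ∷ [])
  δ (run p)  (suc b) | substitute a u l j = just (run p , map suc (image a u b))
  δ (run p)  zero    | decrement a j k    = just (run k , zero ∷ [])
  δ (run p)  (suc b) | decrement a j k    = if does (b ≟ a) then just (skip j , []) else just (run p , suc b ∷ [])
  δ (run p)  x       | stop               = nothing

  open SequentialRun δ

  block : Word → List Letter
  block w = map suc w ++ zero ∷ []

  count<block : ∀ c w → count c w < length (block w)
  count<block c w rewrite length-++ (map Fin.suc w) {zero ∷ []} | length-map Fin.suc w | +-comm (length w) 1 =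
    s≤s (count≤length c w)

  skip-block : ∀ j w → SRun (skip j) (block w) (block w) (run j)
  skip-block j []      = refl ∷ []
  skip-block j (b ∷ w) = refl ∷ skip-block j w

  substitute-block : ∀ {p a u l j} → op p ≡ substitute a u l j → ∀ w →
    SRun (run p) (block w) (block (replace a u w ++ spell l)) (run j)
  substitute-block {p} {l = l} {j} eq [] = subst (λ o → SRun (run p) (block []) o (run j)) (++-identityʳ _) (separator ∷ [])
    where
    separator : δ (run p) zero ≡ just (run j , block (spell l))
    separator rewrite eq = refl
  substitute-block {p} {a} {u} {l} {j} eq (b ∷ w) =
    subst (λ o → SRun (run p) (block (b ∷ w)) o (run j)) regroup (letter ∷ substitute-block eq w)
    where
    letter : δ (run p) (suc b) ≡ just (run p , map suc (image a u b))
    letter rewrite eq = refl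
    regroup : map suc (image a u b) ++ block (replace a u w ++ spell l) ≡ block ((image a u b ++ replace a u w) ++ spell l)
    regroup = begin
      map suc (image a u b) ++ map suc rest ++ end   ≡⟨ ++-assoc (map suc (image a u b)) _ _ ⟨
      (map suc (image a u b) ++ map suc rest) ++ end ≡⟨ cong (_++ end) (map-++ suc (image a u b) rest) ⟨
      map suc (image a u b ++ rest) ++ end           ≡⟨ cong block (++-assoc (image a u b) _ _) ⟨
      block ((image a u b ++ replace a u w) ++ spell l) ∎
      where
      open ≡-Reasoning
      rest = replace a u w ++ spell l
      end = zero ∷ []

  decrement-block : ∀ {p a j k m} → op p ≡ decrement a j k → ∀ w → count a w ≡ suc m →
    SRun (run p) (block w) (block (remove a w)) (run j)
  decrement-block {p} {a} {j} eq (b ∷ w) found with b ≟ a in b≟a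
  ... | yes refl = first ∷ skip-block j w
    where
    first : δ (run p) (suc b) ≡ just (skip j , [])
    first rewrite eq | b≟a = refl
  ... | no b≢a = other ∷ decrement-block eq w (trans (sym (count-other w (λ e → b≢a (sym e)))) found)
    where
    other : δ (run p) (suc b) ≡ just (run p , suc b ∷ [])
    other rewrite eq | b≟a = refl

  exhausted-block : ∀ {p a j k} → op p ≡ decrement a j k → ∀ w → count a w ≡ 0 →
    SRun (run p) (block w) (block w) (run k)
  exhausted-block {p} {k = k} eq [] _ = separator ∷ []
    where
    separator : δ (run p) zero ≡ just (run k , zero ∷ [])
    separator rewrite eq = refl
  exhausted-block {p} {a} eq (b ∷ w) none with b ≟ a in b≟a
  ... | yes refl = case trans (sym (count-same a w)) none of λ ()
  ... | no b≢a = other ∷ exhausted-block eq w (trans (sym (count-other w (λ e → b≢a (sym e)))) none)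
    where
    other : δ (run p) (suc b) ≡ just (run p , suc b ∷ [])
    other rewrite eq | b≟a = refl

  simulate-step : ∀ {p v p′ v′ w} → (p , v) ⟶ (p′ , v′) → w represents v →
    ∃[ w′ ] (SRun (run p) (block w) (block w′) (run p′) × w′ represents v′)
  simulate-step {v = v} {w = w} (substituted {a = a} {u} {l} eq) rep =
    _ , substitute-block eq w , replace-represents {w} {v} a u l rep
  simulate-step {v = v} {w = w} (decremented {a = a} eq found) rep =
    _ , decrement-block eq w (trans (sym (rep a)) found) , remove-represents {w} {v} a rep found
  simulate-step {w = w} (exhausted {a = a} eq none) rep =
    _ , exhausted-block eq w (trans (sym (rep a)) none) , rep

  simulate : ∀ {p v p′ v′ w} → (p , v) ⟶* (p′ , v′) → w represents v →
    ∃[ w′ ] (Trace (run p) (block w) (run p′) (block w′) × w′ represents v′)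
  simulate []      rep = _ , [] , rep
  simulate (e ∷ r) rep with simulate-step e rep
  ... | _ , pass , rep₁ with simulate r rep₁
  ...   | _ , trace , rep′ = _ , pass ∷ trace , rep′

  stop-stuck : ∀ {p} → op p ≡ stop → Stuck (run p)
  stop-stuck eq x rewrite eq = refl

  -- The 2 is the index of the state run start: the initial state and copy precede it.
  record Realisation (start : P) (m : ℕ) : Set where
    field
      transducer   : Word → NFT
      laterCode    : ℕ
      code         : ∀ w → codeNFT (transducer w) ≡
                     transducerCode (controlCount m) n (codeWord (allFin (suc (controlCount m)))) 2 (codeWord (block w)) laterCode
      finiteValued : ∀ w → FiniteValued (transducer w)
      unbounded    : ∀ {w v} → w represents v → ∀ c →
                     (∀ t → ∃[ p ] ∃[ v′ ] ((start , v) ⟶* (p , v′) × t ≤ lookup v′ c)) →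
                     ¬ BoundedTrailing (transducer w)
      bounded      : ∀ {w v p v′} → w represents v → (start , v) ⟶* (p , v′) → op p ≡ stop →
                     BoundedTrailing (transducer w)

  module _ {m : ℕ} (places : Fin m ↔ P) where

    controls : Fin (controlCount m) ↔ Control
    controls = ↔-trans +↔⊎ (↔-trans (1↔⊤ ⊎-↔ ↔-trans +↔⊎ (places ⊎-↔ places))
      (mk↔ₛ′ (λ { (inj₁ _) → copy ; (inj₂ (inj₁ p)) → run p ; (inj₂ (inj₂ p)) → skip p })
             (λ { copy → inj₁ tt ; (run p) → inj₂ (inj₁ p) ; (skip p) → inj₂ (inj₂ p) })
             (λ { copy → refl ; (run p) → refl ; (skip p) → refl })
             (λ { (inj₁ _) → refl ; (inj₂ (inj₁ p)) → refl ; (inj₂ (inj₂ p)) → refl })))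

    realise : ∀ {start} → toℕ (Inverse.from places start) ≡ 0 → Realisation start m
    realise {start} index = record
      { transducer   = λ w → CopyOrAdvance.transducer controls δ copy (run start) copies (block w)
      ; laterCode    = CopyOrAdvance.laterCode controls δ copy (run start) copies
      ; code         = λ w → CopyOrAdvance.code-transducer controls δ copy (run start) copies (block w)
                         {2} {codeWord (block w)} {CopyOrAdvance.laterCode controls δ copy (run start) copies}
                         (cong (2 +_) (trans (toℕ-↑ˡ (Inverse.from places start) m) index)) refl refl
      ; finiteValued = λ w → CopyOrAdvance.finiteValued controls δ copy (run start) copies {block w}
      ; unbounded    = λ {w} rep c grows → CopyOrAdvance.unboundedTrailing controls δ copy (run start) copies {block w} λ t →
          let p , v′ , steps , t≤ = grows t
              w′ , trace , rep′   = simulate steps rep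
          in run p , block w′ , trace ,
             ≤-trans (s≤s (≤-trans t≤ (≤-reflexive (rep′ c)))) (count<block c w′)
      ; bounded      = λ {v′ = v′} rep steps halts → bounded {v′ = v′} (simulate steps rep) halts
      }
      where
      copies : ∀ x → δ copy x ≡ just (copy , x ∷ [])
      copies _ = refl
      bounded : ∀ {w p v′} → ∃[ w′ ] (Trace (run start) (block w) (run p) (block w′) × w′ represents v′) →
        op p ≡ stop → BoundedTrailing (CopyOrAdvance.transducer controls δ copy (run start) copies (block w))
      -- The case split only exposes the last block as a nonempty list.
      bounded {w} ([] , trace , _) halts =
        CopyOrAdvance.boundedTrailing controls δ copy (run start) copies {block w} trace (stop-stuck halts)
      bounded {w} (_ ∷ _ , trace , _) halts =
        CopyOrAdvance.boundedTrailing controls δ copy (run start) copies {block w} trace (stop-stuck halts)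

-- The diagonal counter program.

module _ {A : Set} where

  -- All program counters beyond the program share the last slot, where `at` gives `nothing`; so
  -- finitely many places represent every counter value.
  slot : (as : List A) → ℕ → Fin (suc (length as))
  slot []       _       = zero
  slot (a ∷ as) zero    = zero
  slot (a ∷ as) (suc i) = suc (slot as i)

  at : (as : List A) → Fin (suc (length as)) → Maybe A
  at []       _       = nothing
  at (a ∷ as) zero    = just a
  at (a ∷ as) (suc i) = at as i

  at-slot : ∀ as i → at as (slot as i) ≡ nth as i
  at-slot []       i       = refl
  at-slot (a ∷ as) zero    = refl
  at-slot (a ∷ as) (suc i) = at-slot as i

-- Seven named places, three for each of twelve coding stages, and one for each instruction slot.
placeCount : Machine → ℕ
placeCount M = 7 + (12 * 3 + suc (length (program M)))

registerCount : Machine → ℕ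
registerCount M = 4 + suc (regs M)

module Diagonal (M : Machine) (startCode finalCode lettersCode statesCode : ℕ) where

  private
    r = regs M

  -- X holds the input, N counts the letters of c₀, Z accumulates the code,
  -- S is the argument of tri; the registers of M follow.
  pattern X     = 0F
  pattern N     = 1F
  pattern Z     = 2F
  pattern S     = 3F
  pattern reg i = suc (suc (suc (suc i)))

  Place : Set
  Place = Fin 7 ⊎ ((Fin 12 × Fin 3) ⊎ Fin (suc (length (program M))))

  pattern launch   = inj₁ 0F
  pattern repeat   = inj₁ 1F
  pattern detach   = inj₁ 2F
  pattern transfer = inj₁ 3F
  pattern verdict  = inj₁ 4F
  pattern grow     = inj₁ 5F
  pattern end      = inj₁ 6F
  pattern stage k i = inj₂ (inj₁ (k , i))
  pattern instr i = inj₂ (inj₂ i)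

  places↔ : Fin (placeCount M) ↔ Place
  places↔ = ↔-trans +↔⊎ (↔-refl ⊎-↔ ↔-trans +↔⊎ (*↔× ⊎-↔ ↔-refl))

  pc : ℕ → Place
  pc i = instr (slot (program M) i)

  -- Stage k prepares S = a + b and Z = suc b by firstOp k, then loops until S = 0;
  -- this leaves Z = suc (pair a b).
  next : Fin 12 → Place
  next 0F             = repeat
  next 1F             = stage 2F 0F
  next 2F             = stage 3F 0F
  next 3F             = stage 4F 0F
  next 4F             = detach
  next 5F             = stage 6F 0F
  next 6F             = stage 7F 0F
  next 7F             = stage 8F 0F
  next 8F             = stage 9F 0F
  next 9F             = stage (suc 9F) 0F
  next (suc 9F)       = stage (suc (suc 9F)) 0F
  next (suc (suc 9F)) = transfer

  nil cons : Fin 12 → Op (registerCount M) Place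
  nil k  = substitute Z (S ∷ []) ((Z , 1) ∷ []) (stage k 1F)
  cons k = substitute X (S ∷ Z ∷ []) ((Z , 1) ∷ []) (stage k 1F)

  pushConst : ℕ → Fin 12 → Op (registerCount M) Place
  pushConst c k = substitute Z (S ∷ Z ∷ []) ((Z , 1) ∷ (S , c) ∷ []) (stage k 1F)

  -- Lists are built from their tails. Stage 0 prepends a letter to the code of c₀, stages 1 to 4
  -- wrap it into the first transition, stage 5 joins this to the later transitions, and stages 6 to
  -- 11 prepend the remaining fields of the transducer, last first.
  firstOp : Fin 12 → Op (registerCount M) Place
  firstOp 0F             = pushConst 1 0F
  firstOp 1F             = nil 1F
  firstOp 2F             = pushConst startCode 2F
  firstOp 3F             = pushConst 0 3F
  firstOp 4F             = pushConst 0 4F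
  firstOp 5F             = cons 5F
  firstOp 6F             = nil 6F
  firstOp 7F             = pushConst finalCode 7F
  firstOp 8F             = pushConst 0 8F
  firstOp 9F             = pushConst lettersCode 9F
  firstOp (suc 9F)       = pushConst lettersCode (suc 9F)
  firstOp (suc (suc 9F)) = pushConst statesCode (suc (suc 9F))

  instruction : Maybe (Instr r) → Op (registerCount M) Place
  -- Replacing `X` by itself is a plain jump. A counter outside the program halts the machine just
  -- as `halt` does.
  instruction nothing            = substitute X (X ∷ []) [] verdict
  instruction (just halt)        = substitute X (X ∷ []) [] verdict
  instruction (just (inc i j))   = substitute X (X ∷ []) ((reg i , 1) ∷ []) (pc j)
  instruction (just (dec i j k)) = decrement (reg i) (pc j) (pc k)

  op : Place → Op (registerCount M) Place
  -- The 1 put into `Z` is `codeList (0 ∷ [])`, the code of the lone separator that ends c₀.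
  op launch       = substitute X (X ∷ N ∷ []) ((Z , 1) ∷ []) repeat
  op repeat       = decrement N (stage 0F 0F) (stage 1F 0F)
  op detach       = substitute Z (S ∷ []) [] (stage 5F 0F)
  op transfer     = substitute Z (reg 0F ∷ []) [] (pc 0)
  op verdict      = decrement (reg 0F) grow end
  op grow         = substitute X (X ∷ []) ((X , 1) ∷ []) grow
  op end          = stop
  op (stage k 0F) = firstOp k
  op (stage k 1F) = decrement S (stage k 2F) (next k)
  op (stage k 2F) = substitute S (S ∷ Z ∷ []) ((Z , 1) ∷ []) (stage k 1F)
  op (instr i)    = instruction (at (program M) i)

  open CounterProgram op public

  -- A round that lowers `S` from s + 1 to s adds s + 1 to `Z`; the rounds add up to a triangular
  -- number.
  add-tri : ∀ k {x n z ms} s → (stage k 1F , x ∷ n ∷ z ∷ s ∷ ms) ⟶* (next k , x ∷ n ∷ tri s + z ∷ 0 ∷ ms)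
  add-tri k zero = exhausted refl refl ∷ []
  add-tri k {x} {n} {z} {ms} (suc s) =
    decremented refl refl ∷ substituted refl ∷
    subst (λ y → (stage k 1F , x ∷ n ∷ suc (z + s) ∷ s ∷ ms) ⟶* (next k , x ∷ n ∷ y ∷ 0 ∷ ms))
      (arithmetic (tri s) z s) (add-tri k s)
    where
    arithmetic : ∀ t z s → t + suc (z + s) ≡ suc s + t + z
    arithmetic = solve-∀

  pair-stage : ∀ k {x n ms a b s} → s ≡ a + b →
    (stage k 1F , x ∷ n ∷ suc b ∷ s ∷ ms) ⟶* (next k , x ∷ n ∷ suc (pair a b) ∷ 0 ∷ ms)
  pair-stage k {x} {n} {ms} {a} {b} refl =
    subst (λ y → (stage k 1F , x ∷ n ∷ suc b ∷ a + b ∷ ms) ⟶* (next k , x ∷ n ∷ y ∷ 0 ∷ ms))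
      (+-suc (tri (a + b)) b) (add-tri k (a + b))

  push-stage : ∀ k {c x n ms} l → firstOp k ≡ pushConst c k →
    (stage k 0F , x ∷ n ∷ codeList l ∷ 0 ∷ ms) ⟶* (next k , x ∷ n ∷ codeList (c ∷ l) ∷ 0 ∷ ms)
  push-stage k l eq = substituted eq ∷ pair-stage k refl

  nil-stage : ∀ k {x n ms z} → firstOp k ≡ nil k →
    (stage k 0F , x ∷ n ∷ z ∷ 0 ∷ ms) ⟶* (next k , x ∷ n ∷ codeList (z ∷ []) ∷ 0 ∷ ms)
  nil-stage k {z = z} eq = substituted eq ∷ pair-stage k (sym (+-identityʳ z))

  -- The list head moves from `Z` to `S`, and the untouched input in `X` becomes the tail: here it
  -- serves as the code of the later transitions.
  cons-stage : ∀ {x n ms z} →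
    (detach , x ∷ n ∷ z ∷ 0 ∷ ms) ⟶* (next 5F , 0 ∷ n ∷ suc (pair z x) ∷ 0 ∷ ms)
  cons-stage = substituted refl ∷ substituted refl ∷ pair-stage 5F refl

  prefix : ℕ → List ℕ → List ℕ
  prefix zero    l = l
  prefix (suc n) l = prefix n (1 ∷ l)

  repeat-stage : ∀ {x ms} n l →
    (repeat , x ∷ n ∷ codeList l ∷ 0 ∷ ms) ⟶* (stage 1F 0F , x ∷ 0 ∷ codeList (prefix n l) ∷ 0 ∷ ms)
  repeat-stage zero    l = exhausted refl refl ∷ []
  repeat-stage (suc n) l = decremented refl refl ∷ push-stage 0F l refl ++* repeat-stage n (1 ∷ l)

  -- `x` enters twice, as the number of letters of c₀ before its separator and as the code of the
  -- later transitions. At `x = laterCode` both describe the same transducer.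
  ownCode : ℕ → ℕ
  ownCode x = transducerCode statesCode lettersCode finalCode startCode (codeList (prefix x (0 ∷ []))) x

  compute-ownCode : ∀ x → (launch , x ∷ 0 ∷ 0 ∷ 0 ∷ Vec.replicate (suc r) 0) ⟶*
    (pc 0 , 0 ∷ 0 ∷ 0 ∷ 0 ∷ ownCode x ∷ Vec.replicate r 0)
  compute-ownCode x = subst
    (λ c → (launch , x ∷ 0 ∷ 0 ∷ 0 ∷ Vec.replicate (suc r) 0) ⟶* (pc 0 , 0 ∷ 0 ∷ 0 ∷ 0 ∷ c ∷ Vec.replicate r 0))
    (sym (transducerCode-unfold statesCode lettersCode finalCode startCode word x))
    computation
    where
    word = codeList (prefix x (0 ∷ []))
    transitionsCode = suc (pair (codeList (0 ∷ 0 ∷ startCode ∷ word ∷ [])) x)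
    computation : (launch , x ∷ 0 ∷ 0 ∷ 0 ∷ Vec.replicate (suc r) 0) ⟶*
      (pc 0 , 0 ∷ 0 ∷ 0 ∷ 0 ∷
        codeList (statesCode ∷ lettersCode ∷ lettersCode ∷ 0 ∷ finalCode ∷ transitionsCode ∷ []) ∷ Vec.replicate r 0)
    computation =
      substituted refl ∷
      repeat-stage x (0 ∷ []) ++*
      nil-stage 1F refl ++*
      push-stage 2F (word ∷ []) refl ++*
      push-stage 3F (startCode ∷ word ∷ []) refl ++*
      push-stage 4F (0 ∷ startCode ∷ word ∷ []) refl ++*
      cons-stage ++*
      nil-stage 6F refl ++*
      push-stage 7F (transitionsCode ∷ []) refl ++*
      push-stage 8F (finalCode ∷ transitionsCode ∷ []) refl ++*
      push-stage 9F (0 ∷ finalCode ∷ transitionsCode ∷ []) refl ++*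
      push-stage (suc 9F) (lettersCode ∷ 0 ∷ finalCode ∷ transitionsCode ∷ []) refl ++*
      push-stage (suc (suc 9F)) (lettersCode ∷ lettersCode ∷ 0 ∷ finalCode ∷ transitionsCode ∷ []) refl ++*
      substituted refl ∷ []

  module _ {x n z s : ℕ} where

    machine-step : ∀ {i R i′ R′} → stepM M (i , R) ≡ just (i′ , R′) →
      (pc i , x ∷ n ∷ z ∷ s ∷ R) ⟶ (pc i′ , x ∷ n ∷ z ∷ s ∷ R′)
    machine-step {i} {R} eq with nth (program M) i in at-i
    machine-step {i} {R} refl | just (inc a j) =
      substituted (cong instruction (trans (at-slot (program M) i) at-i))
    machine-step {i} {R} eq | just (dec a j k) with lookup R a in at-a
    machine-step {i} {R} refl | just (dec a j k) | zero =
      exhausted (cong instruction (trans (at-slot (program M) i) at-i)) at-a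
    machine-step {i} {R} refl | just (dec a j k) | suc _ =
      decremented (cong instruction (trans (at-slot (program M) i) at-i)) at-a

    machine-halt : ∀ {i R} → stepM M (i , R) ≡ nothing →
      (pc i , x ∷ n ∷ z ∷ s ∷ R) ⟶ (verdict , x ∷ n ∷ z ∷ s ∷ R)
    machine-halt {i} {R} eq with nth (program M) i in at-i
    machine-halt {i} {R} eq | nothing =
      substituted (cong instruction (trans (at-slot (program M) i) at-i))
    machine-halt {i} {R} eq | just halt =
      substituted (cong instruction (trans (at-slot (program M) i) at-i))
    machine-halt {i} {R} eq | just (dec a j k) with lookup R a
    machine-halt {i} {R} () | just (dec a j k) | zero
    machine-halt {i} {R} () | just (dec a j k) | suc _

    machine-run : ∀ f {i R i′ R′} → runM M f (i , R) ≡ just (i′ , R′) →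
      (pc i , x ∷ n ∷ z ∷ s ∷ R) ⟶* (verdict , x ∷ n ∷ z ∷ s ∷ R′)
    machine-run (suc f) {i} {R} eq with stepM M (i , R) in halted?
    machine-run (suc f) {i} {R} refl | nothing = machine-halt halted? ∷ []
    machine-run (suc f) {i} {R} eq | just _ = machine-step halted? ∷ machine-run f eq

  growing : ∀ {x v} t → ∃[ x′ ] (t ≤ x′ × (grow , x ∷ v) ⟶* (grow , x′ ∷ v))
  growing {x} zero = x , z≤n , []
  growing (suc t) with growing t
  ... | x′ , t≤ , r = suc x′ , s≤s t≤ , r ++* substituted refl ∷ []

  initially : ℕ → Vec ℕ (registerCount M)
  initially x = x ∷ 0 ∷ 0 ∷ 0 ∷ Vec.replicate (suc r) 0

  initially-represents : ∀ x → replicate x X represents initially x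
  initially-represents x 0F      = sym (count-replicate-same X x)
  initially-represents x (suc c) = trans (lookup-replicate c 0) (sym (count-replicate-other {c = suc c} {X} x λ ()))

  reaches-verdict : ∀ x {y} → HaltsWith M (ownCode x) y →
    ∃[ R ] ((launch , initially x) ⟶* (verdict , 0 ∷ 0 ∷ 0 ∷ 0 ∷ R) × lookup R 0F ≡ y)
  reaches-verdict x (f , R , _ , halts , y) = R , compute-ownCode x ++* machine-run f halts , y

  code-initially : ∀ x → codeWord (block (replicate x X)) ≡ codeList (prefix x (0 ∷ []))
  code-initially x = cong codeList (trans (toℕ-block x) (sym (prefix≡ x (0 ∷ []))))
    where
    prefix≡ : ∀ x l → prefix x l ≡ replicate x 1 ++ l
    prefix≡ zero    l = refl
    prefix≡ (suc x) l = trans (prefix≡ x (1 ∷ l)) (shift x)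
      where
      shift : ∀ x → replicate x 1 ++ 1 ∷ l ≡ 1 ∷ replicate x 1 ++ l
      shift zero    = refl
      shift (suc x) = cong (1 ∷_) (shift x)
    toℕ-block : ∀ x → map toℕ (block (replicate x X)) ≡ replicate x 1 ++ 0 ∷ []
    toℕ-block zero    = refl
    toℕ-block (suc x) = cong (1 ∷_) (toℕ-block x)

  module _ {m} (realisation : Realisation launch m) where

    open Realisation realisation

    accept⇒unbounded : ∀ x → HaltsWith M (ownCode x) 1 → ¬ BoundedTrailing (transducer (replicate x X))
    accept⇒unbounded x accepts = unbounded (initially-represents x) X λ t →
      let R , steps , one     = reaches-verdict x accepts
          x′ , t≤x′ , further = growing t
      in grow , (x′ ∷ 0 ∷ 0 ∷ 0 ∷ updateAt R 0F (λ _ → 0)) , steps ++* decremented refl one ∷ further , t≤x′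

    reject⇒bounded : ∀ x → HaltsWith M (ownCode x) 0 → BoundedTrailing (transducer (replicate x X))
    reject⇒bounded x rejects =
      let R , steps , none = reaches-verdict x rejects
      in bounded (initially-represents x) (steps ++* exhausted refl none ∷ []) refl

-- The contradiction for an alleged decider.

module _ (M : Machine) where

  -- There is no circularity: these constants depend only on the numbers of places and registers,
  -- which are fixed by `M` alone.
  open Diagonal M 2 (codeWord (allFin (suc (controlCount (placeCount M))))) (registerCount M) (controlCount (placeCount M))

  refutes : Realisation launch (placeCount M) → ¬ DecidesBoundedTrailing M
  refutes realisation decides = contradictory (decides (transducer input) (finiteValued input))
    where
    open Realisation realisation
    -- The fixed point: `laterCode` does not involve the input word, so the word can spell it out in
    -- unary.
    input = replicate laterCode X
    code-input : codeNFT (transducer input) ≡ ownCode laterCode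
    code-input = trans (code input) (cong
      (λ w → transducerCode (controlCount (placeCount M)) (registerCount M)
        (codeWord (allFin (suc (controlCount (placeCount M))))) 2 w laterCode)
      (code-initially laterCode))
    contradictory : ∃[ b ] (HaltsWith M (codeNFT (transducer input)) (if b then 1 else 0) ×
      (b ≡ true ⇔ BoundedTrailing (transducer input))) → ⊥
    contradictory (true , halts , correct) = accept⇒unbounded realisation laterCode
      (subst (λ c → HaltsWith M c 1) code-input halts) (Equivalence.to correct refl)
    contradictory (false , halts , correct) = case Equivalence.from correct
      (reject⇒bounded realisation laterCode (subst (λ c → HaltsWith M c 0) code-input halts)) of λ ()

  undecided : ¬ DecidesBoundedTrailing M
  undecided = refutes (realise places↔ refl)

theorem3 : ¬ (∃[ M ] DecidesBoundedTrailing M)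
theorem3 (M , decides) = undecided M decides
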